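{- Let $n\ge 1$ and let $\sigma\in S_n$ be a permutation of $[n]=\{1,\dots,n\}$ with $\sigma(1)=1$. For each $d\ge1$ let $\lambda_d$ be the number of cycles of length $d$ of $\sigma$ (fixed points count as cycles of length $1$, so $\lambda_1\ge1$ and $\sum_d d\lambda_d=n$), and set $\mu_d=\sum_{e\mid d,\ e<d} e\lambda_e$. For integers $m,x,y$ put $f(m,x,y)=(mx+y)^{m-1}y$. Then the number of labeled trees on $[n]$, rooted at $1$, that are $\sigma$-invariant equals \[\lambda_1^{\lambda_1-2}\cdot\prod_{d\ge2,\ \lambda_d\neq0} f(\lambda_d,d,\mu_d).\]
   Context: A labeled tree on $[n]$ rooted at $1$ is a spanning tree on the vertex set $[n]$ with distinguished root vertex $1$. Such a tree is $\sigma$-invariant if for every edge $\{i,j\}$ of the tree, $\{\sigma(i),\sigma(j)\}$ is also an edge of the tree. When $\lambda_1=1$, the factor $\lambda_1^{\lambda_1-2}=1^{ -1}$ is read as $1$. -}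

module Defs where

open import Data.Nat using (ℕ; zero; suc; _+_; _*_; _∸_; _^_; _<?_; _≟_)
open import Data.Nat.DivMod using (_/_)
open import Data.Nat.Divisibility using (_∣?_)
open import Data.Bool using (Bool; true; false; if_then_else_)
open import Data.Fin using (Fin)
import Data.Fin.Properties as FinP
open import Data.Fin.Permutation using (Permutation′; _⟨$⟩ʳ_)
open import Data.Vec using (Vec; lookup)
open import Data.List using (List; []; _∷_; length; filter; map; upTo; allFin)
open import Data.Nat.ListAction using (sum; product)
open import Data.List.Relation.Unary.Unique.Propositional using (Unique)
open import Data.List.Membership.Propositional using (_∈_)
open import Data.List.Relation.Unary.Linked using (Linked)
open import Data.Product using (Σ; ∃; _×_)
open import Function.Bundles using (_⇔_)
open import Relation.Nullary using (¬_; does)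
open import Relation.Binary.PropositionalEquality using (_≡_)
open import Relation.Binary.Construct.Closure.ReflexiveTransitive using (Star)

-- Simple graphs on the vertex set Fin n (= [n], vertex 0 plays the role of 1)

AdjMatrix : ℕ → Set
AdjMatrix n = Vec (Vec Bool n) n

Edge : ∀ {n} → AdjMatrix n → Fin n → Fin n → Set
Edge A i j = lookup (lookup A i) j ≡ true

IsSimpleGraph : ∀ {n} → AdjMatrix n → Set
IsSimpleGraph {n} A =
  (∀ (i j : Fin n) → lookup (lookup A i) j ≡ lookup (lookup A j) i) ×
  (∀ (i : Fin n) → lookup (lookup A i) i ≡ false)

Connected : ∀ {n} → AdjMatrix n → Set
Connected {n} A = ∀ (i j : Fin n) → Star (Edge A) i j

record Cycle {n} (A : AdjMatrix n) : Set where
  field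
    v     : Fin n
    ws    : List (Fin n)
    long  : 2 Data.Nat.≤ length ws
    dist  : Unique (v ∷ ws)
    chain : Linked (Edge A) (v ∷ ws Data.List.++ (v ∷ []))

Acyclic : ∀ {n} → AdjMatrix n → Set
Acyclic A = ¬ Cycle A

IsTree : ∀ {n} → AdjMatrix n → Set
IsTree A = IsSimpleGraph A × Connected A × Acyclic A

Invariant : ∀ {n} → Permutation′ n → AdjMatrix n → Set
Invariant {n} σ A = ∀ (i j : Fin n) → Edge A i j → Edge A (σ ⟨$⟩ʳ i) (σ ⟨$⟩ʳ j)

IsInvariantTree : ∀ {n} → Permutation′ n → AdjMatrix n → Set
IsInvariantTree σ A = IsTree A × Invariant σ A

NumberOf : ∀ {n} → (AdjMatrix n → Set) → ℕ → Set
NumberOf {n} P N = Σ (List (AdjMatrix n)) λ l →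
  Unique l × (∀ A → (A ∈ l) ⇔ P A) × length l ≡ N

iter : ∀ {n} → Permutation′ n → ℕ → Fin n → Fin n
iter σ zero i = i
iter σ (suc k) i = σ ⟨$⟩ʳ (iter σ k i)

-- length of the cycle of σ containing i: least k ≥ 1 with σ^k i = i
-- (search over k = 1 .. n; such k ≤ n always exists).
cycleLen : ∀ {n} → Permutation′ n → Fin n → ℕ
cycleLen {n} σ i = go 1 n
  where
  go : ℕ → ℕ → ℕ
  go k zero = k
  go k (suc fuel) = if does (FinP._≟_ (iter σ k i) i) then k else go (suc k) fuel

-- λ_d = number of cycles of length d = (#elements in d-cycles) / d.
lam : ∀ {n} → Permutation′ n → ℕ → ℕ
lam σ zero = 0
lam {n} σ (suc e) =
  length (filter (λ i → cycleLen σ i ≟ suc e) (allFin n)) / suc e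

mu : ∀ {n} → Permutation′ n → ℕ → ℕ
mu σ d = sum (map (λ e → if does (e ∣? d) then e * lam σ e else 0) (upTo d))

f : ℕ → ℕ → ℕ → ℕ
f m x y = (m * x + y) ^ (m ∸ 1) * y

formula : ∀ {n} → Permutation′ n → ℕ
formula {n} σ = (lam σ 1 ^ (lam σ 1 ∸ 2)) * product (map factor (upTo (suc n)))
  where
  factor : ℕ → ℕ
  factor d = if does (d <? 2) then 1
             else if does (lam σ d ≟ 0) then 1
             else f (lam σ d) d (mu σ d)

{-# OPTIONS --safe #-}
-- Sending every vertex to its neighbour towards the root identifies the
-- invariant trees with the functions p on the vertices that commute with σ,
-- fix the root, and eventually lead every vertex to the root. Such a p is
-- determined by the parents it assigns to one representative r of each cycle;
-- the parent of r can be any vertex whose cycle length divides that of r, as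
-- long as the graph on the cycles stays acyclic.
--
-- These assignments are counted by contraction, in the order of decreasing
-- cycle length: once the parent t of r is chosen, the cycle of r is merged with
-- the cycle of t, the possible parents of the other representatives staying
-- the same vertices. For k cycles of length d with S possible parents, y of
-- them not owned by one of the k cycles, the number of choices is y S^(k-1):
-- if x vertices are owned by r and z by the other k - 1 cycles, then
-- S = x + y + z and y (x + y) S^(k-2) + z y S^(k-2) = y S^(k-1).
-- Initially S = d λ_d + μ_d, and y = μ_d for d ≥ 2 while y = 1 for d = 1.
module Submission where

open import Defs
open import Data.Bool using (Bool; true; false; if_then_else_)
open import Data.Empty using (⊥; ⊥-elim)
open import Data.Fin using (Fin; zero; suc; toℕ; fromℕ<)
import Data.Fin.Properties as FinP
open FinP using () renaming (_≟_ to _≟ᶠ_)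
open import Data.Fin.Permutation using (Permutation′; _⟨$⟩ʳ_)
open import Data.List using (List; []; _∷_; _++_; map; filter; upTo; allFin; length)
open import Data.List.Properties using (length-map; length-++; length-upTo; map-++; map-cong; map-cong-local; upTo-∷ʳ)
open import Data.List.Membership.Propositional using (_∈_; _∉_)
open import Data.List.Membership.Propositional.Properties using (∈-++⁺ˡ; ∈-++⁺ʳ; ∈-++⁻; ∈-∃++; ∈-map⁺; ∈-map⁻; ∈-filter⁺; ∈-filter⁻; ∈-allFin; ∈-upTo⁺; ∈-upTo⁻)
open import Data.List.Membership.Propositional.Properties.WithK using (unique∧set⇒bag)
open import Data.List.Relation.Binary.BagAndSetEquality using (∼bag⇒↭)
open import Data.List.Relation.Binary.Permutation.Propositional.Properties using (↭-length)
open import Data.List.Relation.Unary.All as All using (All; []; _∷_)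
import Data.List.Relation.Unary.All.Properties as AllP
open import Data.List.Relation.Unary.AllPairs using ([]; _∷_)
open import Data.List.Relation.Unary.Any using (here; there; any?)
open import Data.List.Relation.Unary.Linked using (Linked; []; [-]; _∷_)
open import Data.List.Relation.Unary.Unique.Propositional using (Unique)
import Data.List.Relation.Unary.Unique.Propositional.Properties as UniqueP
open import Data.Nat
open import Data.Nat.Divisibility using (_∣_; _∣?_; divides; ∣-antisym; ∣-refl; ∣-reflexive; ∣-trans; ∣1⇒≡1; ∣⇒≤; 1∣_; m∣m*n; m%n≡0⇒n∣m)
open import Data.Nat.DivMod using (_/_; _%_; m≡m%n+[m/n]*n; m%n<n; m*n/n≡m)
open import Data.Nat.ListAction using (sum; product)
open import Data.Nat.ListAction.Properties using (sum-++; product-++)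
open import Data.Nat.Properties
open import Data.Nat.Solver using (module +-*-Solver)
open import Data.Product using (Σ; ∃; _×_; _,_; proj₁; proj₂)
open import Data.Sum using (_⊎_; inj₁; inj₂; [_,_]′; swap)
open import Data.Unit using (⊤; tt)
open import Data.Vec using (lookup; tabulate)
open import Data.Vec.Properties using (lookup∘tabulate; tabulate∘lookup; tabulate-cong)
open import Function.Base using (_∘_; id)
open import Function.Bundles using (_⇔_; mk⇔; Equivalence; Inverse)
open import Function.Construct.Composition using (_⇔-∘_)
open import Function.Construct.Symmetry using (⇔-sym)
open import Relation.Binary.Construct.Closure.ReflexiveTransitive using (Star; ε; _◅_; _◅◅_)
open import Relation.Binary.Definitions using (tri<; tri≈; tri>)
open import Relation.Binary.PropositionalEquality
open import Relation.Nullary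
open import Relation.Nullary.Decidable using (_×-dec_; _⊎-dec_; ¬?; dec-true; dec-false; does-⇔)
open import Relation.Nullary.Reflects using (invert)
open import Relation.Unary using (Decidable)

open Equivalence using (to; from)

-- Counting by duplicate-free lists

-- At adjacency matrices this unfolds to the same type as `NumberOf`.
HasSize : {A : Set} → (A → Set) → ℕ → Set
HasSize {A} P N = Σ (List A) λ l → Unique l × (∀ a → (a ∈ l) ⇔ P a) × length l ≡ N

private variable
  A B : Set
  M N : ℕ

size-cong : {P Q : A → Set} → (∀ a → P a ⇔ Q a) → HasSize P N → HasSize Q N
size-cong eq (l , u , mem , len) = l , u , (λ a → eq a ⇔-∘ mem a) , len

size-unique : {P : A → Set} → HasSize P M → HasSize P N → M ≡ N
size-unique (l , u , mem , len) (l′ , u′ , mem′ , len′) = trans (sym len)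
  (trans (↭-length (∼bag⇒↭ (unique∧set⇒bag u u′ λ {x} → ⇔-sym (mem′ x) ⇔-∘ mem x))) len′)

size-empty : {P : A → Set} → (∀ a → ¬ P a) → HasSize P 0
size-empty ¬P = [] , [] , (λ a → mk⇔ (λ ()) (λ p → contradiction p (¬P a))) , refl

size-singleton : {P : A → Set} (a : A) → (∀ b → b ≡ a ⇔ P b) → HasSize P 1
size-singleton a eq = a ∷ [] , [] ∷ [] , (λ b → eq b ⇔-∘ mk⇔ (λ { (here e) → e ; (there ()) }) here) , refl

size-⊎ : {P Q : A → Set} → (∀ a → P a → ¬ Q a) → HasSize P M → HasSize Q N →
  HasSize (λ a → P a ⊎ Q a) (M + N)
size-⊎ dis (l , u , mem , refl) (l′ , u′ , mem′ , refl) =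
  l ++ l′ ,
  UniqueP.++⁺ u u′ (λ {a} (i , j) → dis a (to (mem a) i) (to (mem′ a) j)) ,
  (λ a → mk⇔ ([ inj₁ ∘ to (mem a) , inj₂ ∘ to (mem′ a) ]′ ∘ ∈-++⁻ l)
    [ ∈-++⁺ˡ ∘ from (mem a) , ∈-++⁺ʳ l ∘ from (mem′ a) ]′) ,
  length-++ l

-- Injectivity is asked only on `P`: the maps counted later are injective on good lists, not on all
-- lists.
size-image : {P : A → Set} (f : A → B) → (∀ a a′ → P a → P a′ → f a ≡ f a′ → a ≡ a′) →
  HasSize P N → HasSize (λ b → ∃ λ a → P a × f a ≡ b) N
size-image {P = P} f inj (l , u , mem , len) =
  map f l , unique-map u (λ a → to (mem a)) ,
  (λ b → mk⇔
    (λ i → let a , j , e = ∈-map⁻ f i in a , to (mem a) j , sym e)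
    (λ { (a , p , refl) → ∈-map⁺ f (from (mem a) p) })) ,
  trans (length-map f l) len
  where
  unique-map : ∀ {l} → Unique l → (∀ a → a ∈ l → P a) → Unique (map f l)
  unique-map [] _ = []
  unique-map {a ∷ l} (a∉ ∷ u) all =
    AllP.map⁺ (All.tabulate λ {b} i e → All.lookup a∉ i (inj a b (all a (here refl)) (all b (there i)) e))
    ∷ unique-map u (λ b → all b ∘ there)

size-Σ : {P : A → Set} {Q : A → B → Set} → HasSize P M → (∀ a → P a → HasSize (Q a) N) →
  HasSize (λ (ab : A × B) → P (proj₁ ab) × Q (proj₁ ab) (proj₂ ab)) (M * N)
size-Σ {A = A} {B = B} {N = N} {P} {Q} (l , u , mem , refl) sizeQ =
  size-cong (λ (a , b) → mk⇔ (λ (i , q) → to (mem a) i , q) (λ (p , q) → from (mem a) p , q))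
    (over l u (λ a → sizeQ a ∘ to (mem a)))
  where
  over : ∀ l → Unique l → (∀ a → a ∈ l → HasSize (Q a) N) →
    HasSize (λ (ab : A × B) → proj₁ ab ∈ l × Q (proj₁ ab) (proj₂ ab)) (length l * N)
  over [] _ _ = size-empty λ { _ (() , _) }
  over (a ∷ l) (a∉ ∷ u) size =
    size-cong
      (λ _ → mk⇔ (λ { (inj₁ (b , q , refl)) → here refl , q ; (inj₂ (i , q)) → there i , q })
                 (λ { (here refl , q) → inj₁ (_ , q , refl) ; (there i , q) → inj₂ (i , q) }))
      (size-⊎ (λ { _ (b , q , refl) (i , _) → All.lookup a∉ i refl })
        (size-image (a ,_) (λ { _ _ _ _ refl → refl }) (size a (here refl)))
        (over l u (λ b → size b ∘ there)))

size-filter : ∀ {n} {P : Fin n → Set} (P? : Decidable P) → HasSize P (length (filter P? (allFin n)))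
size-filter {n} P? = filter P? (allFin n) , UniqueP.filter⁺ P? (UniqueP.allFin⁺ n) ,
  (λ a → mk⇔ (proj₂ ∘ ∈-filter⁻ P? {xs = allFin n}) (∈-filter⁺ P? (∈-allFin a))) , refl

-- The search hidden inside `cycleLen`

search : ∀ {n} → Permutation′ n → Fin n → ℕ → ℕ → ℕ
search σ i k zero = k
search σ i k (suc f) = if does (iter σ k i FinP.≟ i) then k else search σ i (suc k) f

-- The local function of cycleLen that performs the search has no name outside
-- Defs, and cycleLen uses n both as its fuel and as the index of Fin n, so that
-- unification cannot recover it from cycleLen directly. Below, the successors
-- of n are hidden behind pred₁ and pred₂; unfolding cycleLen twice uncovers the
-- fuel pred₂ m while the index stays suc (pred₁ m), so the two can be told apart.
opaque
  pred₂ : ℕ → ℕ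
  pred₂ m = m

  pred₂≡ : ∀ m → pred₂ m ≡ m
  pred₂≡ m = refl

abstract
  pred₁ : ℕ → ℕ
  pred₁ m = suc (pred₂ m)

Search : Set
Search = ∀ m (σ : Permutation′ (suc (pred₁ m))) (i : Fin (suc (pred₁ m))) → ℕ

-- The continuation `t` is a parameter, so that unification can find it and `next` can hand it on.
record Unrolls (k : ℕ) (s t : Search) : Set where
  constructor by
  field eq : ∀ m σ i → s m σ i ≡ (if does (iter σ k i FinP.≟ i) then k else t m σ i)

next : ∀ {k s t} → Unrolls k s t → Search
next {t = t} _ = t

step₁ = by {1} {λ _ → cycleLen} {_} (λ _ _ _ → refl)

mutual
  rest : Search
  rest = _
  abstract
    step₂ : Unrolls 2 (next step₁) rest
    step₂ = by {2} {next step₁} {_} (λ _ _ _ → refl)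

-- The `with` in `rest≡hidden` turns the start `3` and the fuel into variables, so that unification
-- can solve `hidden` as the local search itself.
hidden : ∀ m → Permutation′ (suc (pred₁ m)) → Fin (suc (pred₁ m)) → ℕ → ℕ → ℕ
rest≡hidden : ∀ m (σ : Permutation′ (suc (pred₁ m))) i → rest m σ i ≡ hidden m σ i 3 (pred₂ m)
hidden = _
rest≡hidden m σ i with 3 | pred₂ m
... | k | f = refl

hidden≡search : ∀ m (σ : Permutation′ (suc (pred₁ m))) i k f → hidden m σ i k f ≡ search σ i k f
hidden≡search m σ i k zero = refl
hidden≡search m σ i k (suc f) rewrite hidden≡search m σ i (suc k) f = refl

abstract
  cycleLen≡search₂ : ∀ m n (σ : Permutation′ (suc (suc n))) i → pred₂ m ≡ n →
    cycleLen σ i ≡ search σ i 1 (suc (suc n))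
  cycleLen≡search₂ m _ σ i refl rewrite hidden≡search m σ i 2 (suc (pred₂ m)) = refl

cycleLen≡search : ∀ {n} (σ : Permutation′ n) i → cycleLen σ i ≡ search σ i 1 n
cycleLen≡search {suc zero} σ i = refl
cycleLen≡search {suc (suc m)} σ i = cycleLen≡search₂ m m σ i (pred₂≡ m)

-- Non-backtracking walks in trees

module RootedTrees (m : ℕ) where

  V : Set
  V = Fin (suc m)

  Ends : V → List V → Set
  Ends r [] = ⊥
  Ends r (x ∷ []) = x ≡ r
  Ends r (_ ∷ y ∷ l) = Ends r (y ∷ l)

  ends-∈ : ∀ {r} l → Ends r l → r ∈ l
  ends-∈ (x ∷ []) refl = here refl
  ends-∈ (_ ∷ y ∷ l) e = there (ends-∈ (y ∷ l) e)

  ends-snoc : ∀ v l → Ends v (l ++ v ∷ [])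
  ends-snoc v [] = refl
  ends-snoc v (x ∷ []) = refl
  ends-snoc v (x ∷ y ∷ l) = ends-snoc v (y ∷ l)

  module Walks (E : V → V → Set) where

    Step : V → List V → Set
    Step x [] = ⊤
    Step x (y ∷ []) = E x y
    Step x (y ∷ z ∷ _) = E x y × x ≢ z

    -- Non-backtracking walks.
    NB : List V → Set
    NB [] = ⊤
    NB (x ∷ l) = Step x l × NB l

    nb-edge : ∀ {x y} l → NB (x ∷ y ∷ l) → E x y
    nb-edge [] (e , _) = e
    nb-edge (_ ∷ _) ((e , _) , _) = e

    nb-linked : ∀ l → NB l → Linked E l
    nb-linked [] _ = []
    nb-linked (x ∷ []) _ = [-]
    nb-linked (x ∷ y ∷ l) nb = nb-edge l nb ∷ nb-linked (y ∷ l) (proj₂ nb)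

    -- The walk is reduced while it is built: when the next step would undo the new edge, both are
    -- dropped.
    star-nb : ∀ {i j} → Star E i j → ∃ λ l → NB (i ∷ l) × Ends j (i ∷ l)
    star-nb ε = [] , (tt , tt) , refl
    star-nb {i} (e ◅ es) with star-nb es
    ... | [] , nb , end = _ ∷ [] , (e , nb) , end
    ... | z ∷ l , nb , end with i ≟ᶠ z
    ...   | yes refl = l , proj₂ nb , end
    ...   | no i≢z = _ ∷ z ∷ l , ((e , i≢z) , nb) , end

    closed-nb : ∀ v l → Linked E (l ++ v ∷ []) → Unique l → All (v ≢_) l → NB (l ++ v ∷ [])
    closed-nb v [] _ _ _ = tt , tt
    closed-nb v (x ∷ []) (e ∷ _) _ _ = e , tt , tt
    closed-nb v (x ∷ y ∷ []) (e ∷ es) (_ ∷ u) (v≢x ∷ v≢) = (e , v≢x ∘ sym) , closed-nb v (y ∷ []) es u v≢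
    closed-nb v (x ∷ y ∷ z ∷ l) (e ∷ es) ((_ ∷ x≢z ∷ _) ∷ u) (_ ∷ v≢) =
      (e , x≢z) , closed-nb v (y ∷ z ∷ l) es u v≢

  linked-prefix : ∀ {E : V → V → Set} {y ys} xs → Linked E (xs ++ y ∷ ys) → Linked E (xs ++ y ∷ [])
  linked-prefix [] _ = [-]
  linked-prefix (x ∷ []) (e ∷ _) = e ∷ [-]
  linked-prefix (x ∷ x′ ∷ xs) (e ∷ es) = e ∷ linked-prefix (x′ ∷ xs) es

  unique-prefix : ∀ {x : V} {ys} xs → Unique (xs ++ x ∷ ys) → Unique (x ∷ xs)
  unique-prefix [] _ = [] ∷ []
  unique-prefix (w ∷ xs) (w∉ ∷ u) with unique-prefix xs u
  ... | x∉ ∷ u′ = (All.lookup w∉ (∈-++⁺ʳ xs (here refl)) ∘ sym ∷ x∉) ∷ AllP.++⁻ˡ xs w∉ ∷ u′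

  module _ {A : AdjMatrix (suc m)} (simple : IsSimpleGraph A) (acyclic : Acyclic A) where

    open Walks (Edge A)

    edge-sym : ∀ {i j} → Edge A i j → Edge A j i
    edge-sym {i} {j} e = trans (proj₁ simple j i) e

    edge-irrefl : ∀ {i} → ¬ Edge A i i
    edge-irrefl {i} e = contradiction (trans (sym e) (proj₂ simple i)) λ ()

    -- A return to `x` after one step is a loop, after two steps a backtrack, and after more steps a
    -- `Cycle`, as the vertices in between are distinct.
    nb-fresh : ∀ {x} l → NB (x ∷ l) → Unique l → x ∉ l
    nb-fresh l nb u i with ∈-∃++ i
    ... | [] , ys , refl = edge-irrefl (nb-edge ys nb)
    ... | y ∷ [] , ys , refl = proj₂ (proj₁ nb) refl
    ... | ws@(_ ∷ _ ∷ _) , ys , refl = acyclic record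
      { v = _ ; ws = ws ; long = s≤s (s≤s z≤n) ; dist = unique-prefix ws u
      ; chain = linked-prefix (_ ∷ ws) (nb-linked _ nb) }

    nb-unique : ∀ l → NB l → Unique l
    nb-unique [] _ = []
    nb-unique (x ∷ l) nb@(_ , nb′) =
      All.tabulate (λ { i refl → nb-fresh l nb (nb-unique l nb′) i }) ∷ nb-unique l nb′

    -- Moving along the first walk while prolonging the second one backwards
    -- produces a non-backtracking walk from r to r.
    diverge : ∀ {r v a b q} p → NB (v ∷ a ∷ p) → Ends r (a ∷ p) → NB (v ∷ b ∷ q) → Ends r (b ∷ q) → ¬ a ≢ b
    diverge {q = q} [] nb refl nb′ end a≢b
      with nb-unique _ ((edge-sym (nb-edge [] nb) , a≢b) , nb′)
    ... | a∉ ∷ _ = All.lookup a∉ (there (ends-∈ _ end)) refl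
    diverge (c ∷ p) ((e , v≢c) , nb) end nb′ end′ a≢b =
      diverge p nb end ((edge-sym e , a≢b) , nb′) end′ (v≢c ∘ sym)

    same-second : ∀ {r v a b p q} → NB (v ∷ a ∷ p) → Ends r (a ∷ p) → NB (v ∷ b ∷ q) → Ends r (b ∷ q) → a ≡ b
    same-second {a = a} {b} nb end nb′ end′ with a ≟ᶠ b
    ... | yes e = e
    ... | no a≢b = ⊥-elim (diverge _ nb end nb′ end′ a≢b)

  -- From parent functions to trees

  -- The condition v ≢ zero makes proofs unique, so that their depth is a function of v.
  data Rooted (p : V → V) : V → Set where
    root : Rooted p zero
    step : ∀ {v} → v ≢ zero → Rooted p (p v) → Rooted p v

  ParentEdge : (V → V) → V → V → Set
  ParentEdge p i j = (i ≢ zero × p i ≡ j) ⊎ (j ≢ zero × p j ≡ i)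

  parentEdge? : ∀ p i j → Dec (ParentEdge p i j)
  parentEdge? p i j = (¬? (i ≟ᶠ zero) ×-dec (p i ≟ᶠ j)) ⊎-dec (¬? (j ≟ᶠ zero) ×-dec (p j ≟ᶠ i))

  matrix : (V → V) → AdjMatrix (suc m)
  matrix p = tabulate λ i → tabulate λ j → does (parentEdge? p i j)

  matrix-entry : ∀ p i j → lookup (lookup (matrix p) i) j ≡ does (parentEdge? p i j)
  matrix-entry p i j = trans
    (cong (λ row → lookup row j) (lookup∘tabulate (λ i → tabulate λ j → does (parentEdge? p i j)) i))
    (lookup∘tabulate (λ j → does (parentEdge? p i j)) j)

  matrix-edge : ∀ p i j → Edge (matrix p) i j ⇔ ParentEdge p i j
  matrix-edge p i j = mk⇔
    (λ e → invert (subst (Reflects _) (trans (sym (matrix-entry p i j)) e) (proof (parentEdge? p i j))))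
    (λ e → trans (matrix-entry p i j) (dec-true (parentEdge? p i j) e))

  matrix-unique : ∀ {p} A → (∀ i j → Edge A i j ⇔ ParentEdge p i j) → matrix p ≡ A
  matrix-unique {p} A eq = trans
    (tabulate-cong λ i → trans (tabulate-cong λ j → entry i j) (tabulate∘lookup (lookup A i)))
    (tabulate∘lookup A)
    where
    entry : ∀ i j → does (parentEdge? p i j) ≡ lookup (lookup A i) j
    entry i j with lookup (lookup A i) j | eq i j
    ... | true | eq′ = dec-true (parentEdge? p i j) (to eq′ refl)
    ... | false | eq′ = dec-false (parentEdge? p i j) (λ e → contradiction (from eq′ e) λ ())

  module _ {p : V → V} where

    depth : ∀ {v} → Rooted p v → ℕ
    depth root = 0
    depth (step _ r) = suc (depth r)

    depth-unique : ∀ {v} (r r′ : Rooted p v) → depth r ≡ depth r′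
    depth-unique root root = refl
    depth-unique root (step 0≢0 _) = contradiction refl 0≢0
    depth-unique (step 0≢0 _) root = contradiction refl 0≢0
    depth-unique (step _ r) (step _ r′) = cong suc (depth-unique r r′)

    module _ (rooted : ∀ v → Rooted p v) where

      height : V → ℕ
      height v = depth (rooted v)

      height-< : ∀ {v} → v ≢ zero → height (p v) < height v
      height-< {v} v≢0 = ≤-reflexive (depth-unique (step v≢0 (rooted (p v))) (rooted v))

      height-suc : ∀ {v} → v ≢ zero → height v ≡ suc (height (p v))
      height-suc {v} v≢0 = depth-unique (rooted v) (step v≢0 (rooted (p v)))

      matrix-simple : IsSimpleGraph (matrix p)
      matrix-simple =
        (λ i j → trans (matrix-entry p i j) (trans
          (does-⇔ (mk⇔ swap swap) (parentEdge? p i j) (parentEdge? p j i)) (sym (matrix-entry p j i)))) ,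
        (λ i → trans (matrix-entry p i i) (dec-false (parentEdge? p i i) (irrefl i)))
        where
        irrefl : ∀ i → ¬ ParentEdge p i i
        irrefl i (inj₁ (i≢0 , e)) = <⇒≢ (height-< i≢0) (cong height e)
        irrefl i (inj₂ (i≢0 , e)) = <⇒≢ (height-< i≢0) (cong height e)

      matrix-connected : Connected (matrix p)
      matrix-connected i j = up (rooted i) ◅◅ down (rooted j)
        where
        up : ∀ {v} → Rooted p v → Star (Edge (matrix p)) v zero
        up root = ε
        up (step v≢0 r) = from (matrix-edge p _ _) (inj₁ (v≢0 , refl)) ◅ up r
        down : ∀ {v} → Rooted p v → Star (Edge (matrix p)) zero v
        down root = ε
        down (step v≢0 r) = down r ◅◅ from (matrix-edge p _ _) (inj₂ (v≢0 , refl)) ◅ ε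

      open Walks (Edge (matrix p))

      Down : V → V → Set
      Down x y = y ≢ zero × p y ≡ x

      down-< : ∀ {x y} → Down x y → height x < height y
      down-< (y≢0 , refl) = height-< y≢0

      -- A step up after a step down would backtrack, so once a walk goes down it goes down forever.
      down-forever : ∀ {x y z} l → NB (x ∷ y ∷ l) → Down x y → Ends z (y ∷ l) → height x < height z
      down-forever [] nb d refl = down-< d
      down-forever {x} {y} (w ∷ l) nb@((_ , x≢w) , nb′) d end with to (matrix-edge p y w) (nb-edge l nb′)
      ... | inj₁ (_ , e) = contradiction (trans (sym (proj₂ d)) e) x≢w
      ... | inj₂ d′ = <-trans (down-< d) (down-forever l nb′ d′ end)

      penultimate : V → V → List V → V
      penultimate x y [] = x
      penultimate x y (w ∷ l) = penultimate y w l

      penultimate-∈ : ∀ x y v l → penultimate x y (l ++ v ∷ []) ∈ y ∷ l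
      penultimate-∈ x y v [] = here refl
      penultimate-∈ x y v (w ∷ l) = there (penultimate-∈ y w v l)

      -- If the last step goes down, it comes from the parent of `z`. If it goes up, so did all
      -- earlier ones by `down-forever`, and the height has dropped.
      last-step : ∀ {x y z} l → NB (x ∷ y ∷ l) → Ends z (y ∷ l) →
        p z ≡ penultimate x y l ⊎ height z < height x
      last-step {x} {y} [] nb refl with to (matrix-edge p x y) (proj₁ nb)
      ... | inj₁ (x≢0 , refl) = inj₂ (height-< x≢0)
      ... | inj₂ (_ , e) = inj₁ e
      last-step {x} {y} (w ∷ l) nb@(_ , nb′) end with last-step l nb′ end
      ... | inj₁ e = inj₁ e
      ... | inj₂ lt with to (matrix-edge p x y) (nb-edge (w ∷ l) nb)
      ...   | inj₁ (x≢0 , refl) = inj₂ (<-trans lt (height-< x≢0))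
      -- Since `y` is just one level deeper than `x`, `height z < height y` puts `z` no deeper than
      -- `x`, yet a walk starting downwards ends strictly deeper.
      ...   | inj₂ d@(y≢0 , refl) = contradiction (down-forever (w ∷ l) nb d end)
        (<⇒≱ lt ∘ subst (_≤ _) (sym (height-suc y≢0)))

      -- Around a cycle from `v` to `v` the first step cannot go down, so it leads to the parent `a`
      -- of `v`; by `last-step` the last step comes from the parent of `v` as well. These are two
      -- distinct vertices of the cycle.
      matrix-acyclic : Acyclic (matrix p)
      matrix-acyclic record { ws = _ ∷ [] ; long = s≤s () }
      matrix-acyclic record { v = v ; ws = a ∷ b ∷ ws ; dist = (v∉@(_ ∷ v≢b ∷ _) ∷ u@(a∉ ∷ _)) ; chain = e ∷ es } =
        impossible (to (matrix-edge p v a) e) (last-step (b ∷ ws ++ v ∷ []) nb end)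
        where
        nb : NB (v ∷ a ∷ b ∷ ws ++ v ∷ [])
        nb = (e , v≢b) , closed-nb v (a ∷ b ∷ ws) es u v∉
        end : Ends v (a ∷ b ∷ ws ++ v ∷ [])
        end = ends-snoc v (a ∷ b ∷ ws)
        impossible : ParentEdge p v a → p v ≡ penultimate v a (b ∷ ws ++ v ∷ []) ⊎ height v < height v → ⊥
        impossible _ (inj₂ lt) = <-irrefl refl lt
        impossible (inj₂ d) _ = <-irrefl refl (down-forever (b ∷ ws ++ v ∷ []) nb d end)
        impossible (inj₁ (_ , pv≡a)) (inj₁ e) =
          All.lookup a∉ (subst (_∈ b ∷ ws) (trans (sym e) pv≡a) (penultimate-∈ a b v ws)) refl

      matrix-tree : IsTree (matrix p)
      matrix-tree = matrix-simple , matrix-connected , matrix-acyclic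

  -- Induction from the root. The edge from `v` to `p v` could otherwise only come from
  -- `p′ (p v) ≡ v`; but `p′ (p v)` is `p (p v)` by induction, which lies strictly closer to the
  -- root than `v`.
  matrix-injective : ∀ {p p′} → (∀ v → Rooted p v) → p zero ≡ zero → p′ zero ≡ zero →
    matrix p ≡ matrix p′ → ∀ v → p′ v ≡ p v
  matrix-injective {p} {p′} rooted p0 p′0 eq v = go (rooted v)
    where
    go : ∀ {v} → Rooted p v → p′ v ≡ p v
    go root = trans p′0 (sym p0)
    go {v} (step v≢0 r) with to (matrix-edge p′ v (p v))
      (subst (λ A → Edge A v (p v)) eq (from (matrix-edge p v (p v)) (inj₁ (v≢0 , refl))))
    ... | inj₁ (_ , e) = e
    ... | inj₂ (pv≢0 , e) = contradiction
      (cong (height rooted) (trans (sym (go r)) e)) (<⇒≢ (<-trans (height-< rooted pv≢0) (height-< rooted v≢0)))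

  -- From trees to parent functions

  module Parent {A : AdjMatrix (suc m)} (tree : IsTree A) where

    open Walks (Edge A) public

    private
      simple : IsSimpleGraph A
      simple = proj₁ tree
      connected : Connected A
      connected = proj₁ (proj₂ tree)
      acyclic : Acyclic A
      acyclic = proj₂ (proj₂ tree)

    second : ∀ {r v} l → v ≢ r → Ends r (v ∷ l) → V
    second [] v≢r e = contradiction e v≢r
    second (a ∷ _) _ _ = a

    walk : ∀ v → ∃ λ l → NB (v ∷ l) × Ends zero (v ∷ l)
    walk v = star-nb (connected v zero)

    parent : V → V
    -- The root is its own parent by convention, which lets `parent` commute with maps fixing the
    -- root.
    parent zero = zero
    parent v@(suc _) = second (proj₁ (walk v)) (λ ()) (proj₂ (proj₂ (walk v)))

    -- `same-second` makes the walk chosen in `parent` immaterial, and `nb-unique` prevents a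
    -- nonempty walk to the root from starting there.
    walk-parent : ∀ {v a} l → NB (v ∷ a ∷ l) → Ends zero (a ∷ l) → v ≢ zero × parent v ≡ a
    walk-parent {zero} l nb end with nb-unique simple acyclic _ nb
    ... | 0∉ ∷ _ = contradiction refl (All.lookup 0∉ (ends-∈ _ end))
    walk-parent {v@(suc _)} l nb end = (λ ()) , first-step (walk v)
      where
      first-step : (w : ∃ λ l → NB (v ∷ l) × Ends zero (v ∷ l)) →
        second (proj₁ w) (λ ()) (proj₂ (proj₂ w)) ≡ _
      first-step (b ∷ l′ , nb′ , end′) = same-second simple acyclic nb′ end′ nb end

    parent-rooted : ∀ v → Rooted parent v
    parent-rooted v = go (proj₁ (walk v)) (proj₁ (proj₂ (walk v))) (proj₂ (proj₂ (walk v)))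
      where
      go : ∀ {v} l → NB (v ∷ l) → Ends zero (v ∷ l) → Rooted parent v
      go [] _ refl = root
      go (a ∷ l) nb end with walk-parent l nb end
      ... | v≢0 , refl = step v≢0 (go l (proj₂ nb) end)

    parent-walk : ∀ {v} → v ≢ zero → ∃ λ l → NB (v ∷ parent v ∷ l) × Ends zero (parent v ∷ l)
    parent-walk {v} v≢0 with walk v
    ... | [] , _ , e = contradiction e v≢0
    ... | a ∷ l , nb , end with walk-parent l nb end
    ...   | _ , refl = l , nb , end

    -- Given an edge, take the reduced walk from `j` to the root. Either it starts with `i`, the
    -- parent of `j`, or prefixing `i` keeps it reduced and shows that `j` is the parent of `i`.
    edge⇔parent : ∀ i j → Edge A i j ⇔ ParentEdge parent i j
    edge⇔parent i j = mk⇔ ⇒ λ { (inj₁ (i≢0 , refl)) → up i≢0 ; (inj₂ (j≢0 , refl)) → edge-sym simple acyclic (up j≢0) }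
      where
      up : ∀ {i} → i ≢ zero → Edge A i (parent i)
      up i≢0 with parent-walk i≢0
      ... | l , nb , _ = nb-edge l nb
      ⇒ : Edge A i j → ParentEdge parent i j
      ⇒ e with walk j
      ... | [] , nb , end = inj₁ (walk-parent [] (e , nb) end)
      ... | z ∷ l , nb , end with i ≟ᶠ z
      ...   | yes refl = inj₂ (walk-parent l nb end)
      ...   | no i≢z = inj₁ (walk-parent (z ∷ l) ((e , i≢z) , nb) end)

    matrix-parent : matrix parent ≡ A
    matrix-parent = matrix-unique A edge⇔parent

    -- The image of a reduced walk to the root is again one; injectivity of `s` preserves the
    -- absence of backtracking.
    parent-commutes : (s : V → V) → (∀ {i j} → s i ≡ s j → i ≡ j) → s zero ≡ zero →
      (∀ i j → Edge A i j → Edge A (s i) (s j)) → ∀ v → parent (s v) ≡ s (parent v)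
    parent-commutes s inj s0 inv v with v ≟ᶠ zero
    ... | yes refl = trans (cong parent s0) (sym s0)
    ... | no v≢0 with parent-walk v≢0
    ...   | l , nb , end = proj₂ (walk-parent (map s l) (map-nb _ nb) (map-ends (parent v ∷ l) end))
      where
      map-nb : ∀ l → NB l → NB (map s l)
      map-nb [] _ = tt
      map-nb (x ∷ []) _ = tt , tt
      map-nb (x ∷ y ∷ []) (e , nb) = inv x y e , map-nb (y ∷ []) nb
      map-nb (x ∷ y ∷ z ∷ l) ((e , x≢z) , nb) = (inv x y e , x≢z ∘ inj) , map-nb (y ∷ z ∷ l) nb
      map-ends : ∀ l → Ends zero l → Ends zero (map s l)
      map-ends (x ∷ []) refl = s0
      map-ends (x ∷ y ∷ l) end = map-ends (y ∷ l) end

-- Cycle lengths of `σ`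

module InvariantTrees (m : ℕ) (σ : Permutation′ (suc m)) (σ0 : σ ⟨$⟩ʳ zero ≡ zero) where

  open RootedTrees m

  s : V → V
  s = σ ⟨$⟩ʳ_

  s-injective : ∀ {i j} → s i ≡ s j → i ≡ j
  s-injective {i} {j} e = trans (sym (Inverse.strictlyInverseʳ σ i))
    (trans (cong (Inverse.from σ) e) (Inverse.strictlyInverseʳ σ j))

  iter-+ : ∀ a b i → iter σ (a + b) i ≡ iter σ a (iter σ b i)
  iter-+ zero b i = refl
  iter-+ (suc a) b i = cong s (iter-+ a b i)

  iter-injective : ∀ k {i j} → iter σ k i ≡ iter σ k j → i ≡ j
  iter-injective zero e = e
  iter-injective (suc k) e = iter-injective k (s-injective e)

  iter-s : ∀ k i → iter σ k (s i) ≡ s (iter σ k i)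
  iter-s zero i = refl
  iter-s (suc k) i = cong s (iter-s k i)

  iter-zero : ∀ k → iter σ k zero ≡ zero
  iter-zero zero = refl
  iter-zero (suc k) = trans (cong s (iter-zero k)) σ0

  len : V → ℕ
  len = cycleLen σ

  Returns : V → ℕ → Set
  Returns i k = iter σ k i ≡ i

  search-lower : ∀ i k f → k ≤ search σ i k f
  search-lower i k zero = ≤-refl
  search-lower i k (suc f) with iter σ k i FinP.≟ i
  ... | yes _ = ≤-refl
  ... | no _ = <⇒≤ (search-lower i (suc k) f)

  search-minimal : ∀ i k f j → k ≤ j → j < search σ i k f → ¬ Returns i j
  search-minimal i k zero j k≤j j<k _ = <⇒≱ j<k k≤j
  search-minimal i k (suc f) j k≤j j< r with iter σ k i FinP.≟ i
  ... | yes _ = <⇒≱ j< k≤j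
  ... | no k↛ with k ≟ j
  ...   | yes refl = k↛ r
  ...   | no k≢j = search-minimal i (suc k) f j (≤∧≢⇒< k≤j k≢j) j< r

  search-returns : ∀ i k f j → k ≤ j → j < k + f → Returns i j → Returns i (search σ i k f)
  search-returns i k zero j k≤j j< _ = contradiction k≤j (<⇒≱ (subst (j <_) (+-identityʳ k) j<))
  search-returns i k (suc f) j k≤j j< r with iter σ k i FinP.≟ i
  ... | yes e = e
  ... | no k↛ with k ≟ j
  ...   | yes refl = contradiction r k↛
  ...   | no k≢j = search-returns i (suc k) f j (≤∧≢⇒< k≤j k≢j) (subst (j <_) (+-suc k f) j<) r

  -- Two of the iterates with exponents `0` to `suc m` coincide; cancelling the smaller exponent
  -- leaves a return.
  some-return : ∀ i → ∃ λ j → 1 ≤ j × j < 1 + suc m × Returns i j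
  some-return i = toℕ b ∸ toℕ a , m<n⇒0<n∸m a<b , s≤s (≤-trans (m∸n≤m (toℕ b) (toℕ a)) (FinP.toℕ≤pred[n] b)) ,
    iter-injective (toℕ a) (trans (sym (iter-+ (toℕ a) (toℕ b ∸ toℕ a) i))
      (trans (cong (λ k → iter σ k i) (m+[n∸m]≡n (<⇒≤ a<b))) (sym e)))
    where
    collision = FinP.pigeonhole (n<1+n (suc m)) (λ k → iter σ (toℕ k) i)
    a = proj₁ collision
    b = proj₁ (proj₂ collision)
    a<b = proj₁ (proj₂ (proj₂ collision))
    e = proj₂ (proj₂ (proj₂ collision))

  len-returns : ∀ i → Returns i (len i)
  len-returns i with j , 1≤j , j< , r ← some-return i =
    subst (Returns i) (sym (cycleLen≡search σ i)) (search-returns i 1 (suc m) j 1≤j j< r)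

  len>0 : ∀ i → 0 < len i
  len>0 i = subst (0 <_) (sym (cycleLen≡search σ i)) (search-lower i 1 (suc m))

  len-minimal : ∀ i j → 0 < j → j < len i → ¬ Returns i j
  len-minimal i j 0<j j< = search-minimal i 1 (suc m) j 0<j (subst (j <_) (cycleLen≡search σ i) j<)

  instance
    len-nonZero : ∀ {i} → NonZero (len i)
    len-nonZero {i} = >-nonZero (len>0 i)

  len≤n : ∀ i → len i ≤ suc m
  len≤n i with j , 1≤j , j< , r ← some-return i =
    ≮⇒≥ λ n< → len-minimal i j 1≤j (<-≤-trans j< n<) r

  returns-* : ∀ i L q → Returns i L → Returns i (q * L)
  returns-* i L zero _ = refl
  returns-* i L (suc q) r = trans (iter-+ L (q * L) i) (trans (cong (iter σ L) (returns-* i L q r)) r)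

  iter-% : ∀ k i → iter σ k i ≡ iter σ (k % len i) i
  iter-% k i = trans (cong (λ k → iter σ k i) (m≡m%n+[m/n]*n k (len i)))
    (trans (iter-+ (k % len i) _ i) (cong (iter σ (k % len i)) (returns-* i (len i) (k / len i) (len-returns i))))

  returns⇔len∣ : ∀ i k → Returns i k ⇔ len i ∣ k
  returns⇔len∣ i k = mk⇔ ⇒ λ { (divides q refl) → returns-* i (len i) q (len-returns i) }
    where
    ⇒ : Returns i k → len i ∣ k
    ⇒ r with k % len i in eq
    ... | zero = m%n≡0⇒n∣m k (len i) eq
    ... | suc j = contradiction (trans (sym (iter-% k i)) r)
      (len-minimal i (k % len i) (subst (0 <_) (sym eq) z<s) (m%n<n k (len i)))

  len-s : ∀ i → len (s i) ≡ len i
  len-s i = ∣-antisym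
    (to (returns⇔len∣ (s i) (len i)) (trans (iter-s (len i) i) (cong s (len-returns i))))
    (to (returns⇔len∣ i (len (s i)))
      (s-injective (trans (sym (iter-s (len (s i)) i)) (len-returns (s i)))))

  len-iter : ∀ k i → len (iter σ k i) ≡ len i
  len-iter zero i = refl
  len-iter (suc k) i = trans (len-s (iter σ k i)) (len-iter k i)

  len-zero : len zero ≡ 1
  len-zero = ∣1⇒≡1 (to (returns⇔len∣ zero 1) σ0)

  -- Orbits and their representatives

  -- Bounding the exponent by the number of vertices makes the relation decidable; `↝-iter` reduces
  -- larger exponents modulo the cycle length.
  _↝_ : V → V → Set
  i ↝ j = ∃ λ (k : V) → iter σ (toℕ k) i ≡ j

  _↝?_ : ∀ i j → Dec (i ↝ j)
  i ↝? j = FinP.any? λ k → iter σ (toℕ k) i FinP.≟ j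

  ↝-iter : ∀ k i → i ↝ iter σ k i
  ↝-iter k i = fromℕ< r<n , trans (cong (λ k → iter σ k i) (FinP.toℕ-fromℕ< r<n)) (sym (iter-% k i))
    where
    r<n : k % len i < suc m
    r<n = <-≤-trans (m%n<n k (len i)) (len≤n i)

  ↝-trans : ∀ {i j k} → i ↝ j → j ↝ k → i ↝ k
  ↝-trans {i} (a , refl) (b , refl) = subst (i ↝_) (iter-+ (toℕ b) (toℕ a) i) (↝-iter (toℕ b + toℕ a) i)

  -- Completing `toℕ k` steps to `len i * toℕ k` steps leads back to `i`.
  ↝-sym : ∀ {i j} → i ↝ j → j ↝ i
  ↝-sym {i} {j} (k , refl) = subst (iter σ (toℕ k) i ↝_)
    (trans (sym (iter-+ (len i * toℕ k ∸ toℕ k) (toℕ k) i))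
      (trans (cong (λ a → iter σ a i) (m∸n+n≡m (m≤n*m (toℕ k) (len i))))
        (from (returns⇔len∣ i (len i * toℕ k)) (m∣m*n (toℕ k)))))
    (↝-iter (len i * toℕ k ∸ toℕ k) (iter σ (toℕ k) i))

  first : ∀ {n} → (Fin (suc n) → Bool) → Fin (suc n)
  first {zero} b = zero
  first {suc n} b = if b zero then zero else suc (first (b ∘ suc))

  first-true : ∀ {n} (b : Fin (suc n) → Bool) i → b i ≡ true → b (first b) ≡ true
  first-true {zero} b zero e = e
  first-true {suc n} b i e with b zero in eq
  ... | true = eq
  first-true {suc n} b zero e | false = contradiction (trans (sym eq) e) λ ()
  first-true {suc n} b (suc i) e | false = first-true (b ∘ suc) i e

  first-cong : ∀ {n} {b b′ : Fin (suc n) → Bool} → (∀ i → b i ≡ b′ i) → first b ≡ first b′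
  first-cong {zero} eq = refl
  first-cong {suc n} {b} {b′} eq with b zero | b′ zero | eq zero
  ... | true | _ | refl = refl
  ... | false | _ | refl = cong suc (first-cong (eq ∘ suc))

  -- `first` sees only truth values, so vertices with the same orbit get equal representatives.
  rep : V → V
  rep i = first λ j → does (i ↝? j)

  ↝rep : ∀ i → i ↝ rep i
  ↝rep i with i ↝? rep i in eq
  ... | yes r = r
  ... | no _ = contradiction (trans (sym (cong does eq))
    (first-true (λ j → does (i ↝? j)) i (dec-true (i ↝? i) (zero , refl)))) λ ()

  rep-↝ : ∀ {i j} → i ↝ j → rep i ≡ rep j
  rep-↝ {i} {j} r = first-cong λ k → does-⇔ (mk⇔ (↝-trans (↝-sym r)) (↝-trans r)) (i ↝? k) (j ↝? k)

  rep-iter : ∀ k i → rep (iter σ k i) ≡ rep i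
  rep-iter k i = sym (rep-↝ (↝-iter k i))

  rep-idem : ∀ i → rep (rep i) ≡ rep i
  rep-idem i = sym (rep-↝ (↝rep i))

  len-rep : ∀ i → len (rep i) ≡ len i
  len-rep i with k , e ← ↝rep i = trans (cong len (sym e)) (len-iter (toℕ k) i)

  rep-zero : rep zero ≡ zero
  rep-zero with k , e ← ↝rep zero = trans (sym e) (iter-zero (toℕ k))

  rep≡zero : ∀ i → rep i ≡ zero → i ≡ zero
  rep≡zero i e with k , r ← ↝rep i = iter-injective (toℕ k) (trans r (trans e (sym (iter-zero (toℕ k)))))

  exponent : V → ℕ
  exponent i = toℕ (proj₁ (↝-sym (↝rep i)))

  iter-exponent : ∀ i → iter σ (exponent i) (rep i) ≡ i
  iter-exponent i = proj₂ (↝-sym (↝rep i))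

  -- The iterates with exponents below `len r` are distinct by minimality of `len r`, and reduction
  -- modulo `len r` shows that they exhaust the orbit.
  size-orbit : ∀ r → rep r ≡ r → HasSize (λ i → rep i ≡ r) (len r)
  size-orbit r e = size-cong
    (λ i → mk⇔ (λ { (k , _ , refl) → trans (rep-iter k r) e })
               (λ { refl → exponent i % len r , m%n<n (exponent i) (len r) ,
                           trans (sym (iter-% (exponent i) r)) (iter-exponent i) }))
    (size-image (λ k → iter σ k r) inj
      (upTo (len r) , UniqueP.upTo⁺ (len r) , (λ _ → mk⇔ ∈-upTo⁻ ∈-upTo⁺) , length-upTo (len r)))
    where
    inj< : ∀ a b → a < b → b < len r → ¬ iter σ a r ≡ iter σ b r
    inj< a b a<b b< e = len-minimal r (b ∸ a) (m<n⇒0<n∸m a<b) (≤-<-trans (m∸n≤m b a) b<)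
      (iter-injective a (trans (sym (iter-+ a (b ∸ a) r))
        (trans (cong (λ k → iter σ k r) (m+[n∸m]≡n (<⇒≤ a<b))) (sym e))))
    inj : ∀ a b → a < len r → b < len r → iter σ a r ≡ iter σ b r → a ≡ b
    inj a b a< b< e with <-cmp a b
    ... | tri< a<b _ _ = contradiction e (inj< a b a<b b<)
    ... | tri≈ _ a≡b _ = a≡b
    ... | tri> _ _ b<a = contradiction (sym e) (inj< b a b<a a<)

  -- Counting good parent lists by contraction

  _∈?_ : (t : V) (l : List V) → Dec (t ∈ l)
  t ∈? l = any? (t ≟ᶠ_) l

  -- The owner map o sends each vertex to the root or to the representative of an
  -- orbit; merge contracts the orbit of r into the orbit of u.
  merge : V → V → (V → V) → V → V
  merge r u o t = if does (o t ≟ᶠ r) then u else o t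

  module _ (o : V → V) {r u t : V} where
    merge-hit : o t ≡ r → merge r u o t ≡ u
    merge-hit e with o t ≟ᶠ r
    ... | yes _ = refl
    ... | no ≢ = contradiction e ≢

    merge-miss : o t ≢ r → merge r u o t ≡ o t
    merge-miss ≢ with o t ≟ᶠ r
    ... | yes e = contradiction e ≢
    ... | no _ = refl

  -- A list g of parents for the representatives rs is good if successively
  -- contracting each orbit into the orbit of its parent never meets a loop.
  Good : List V → (V → V) → List V → Set
  Good [] o [] = ⊤
  Good [] o (_ ∷ _) = ⊥
  Good (_ ∷ _) o [] = ⊥
  Good (r ∷ rs) o (t ∷ g) = len t ∣ len r × o t ≢ r × Good rs (merge r (o t) o) g

  -- No orbit of elements with cycles shorter than d has been contracted.
  Lower : ℕ → (V → V) → Set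
  Lower d o = ∀ t → len t < d → o t ≡ rep t

  -- A vertex on a shorter cycle is still owned by its representative, whose cycle length differs
  -- from that of `r`.
  lower-merge : ∀ {d r u o} → len r ≡ d → Lower d o → Lower d (merge r u o)
  lower-merge {d} {r} {u} {o} lr low t lt = trans (merge-miss o miss) (low t lt)
    where
    miss : o t ≢ r
    miss e = <⇒≢ lt (trans (sym (len-rep t)) (trans (cong len (trans (sym (low t lt)) e)) lr))

  size-∷ : ∀ {P : V → Set} {Q : V → List V → Set} {M N} → HasSize P M → (∀ t → P t → HasSize (Q t) N) →
    HasSize (λ g → ∃ λ (tg : V × List V) → (P (proj₁ tg) × Q (proj₁ tg) (proj₂ tg)) × proj₁ tg ∷ proj₂ tg ≡ g) (M * N)
  size-∷ p q = size-image (λ (t , g) → t ∷ g) (λ { _ _ _ _ refl → refl }) (size-Σ p q)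

  -- This is `y S^(k-1)`, with value 1 for the empty block, matching the lengths that the product in
  -- the theorem omits.
  blockCount : ℕ → ℕ → ℕ → ℕ
  blockCount zero S y = 1
  blockCount (suc k) S y = S ^ k * y

  -- The recursion for `k ≥ 2` orbits, with `P = S^(k-2)` and `C` the count for the shorter cycles.
  -- The two summands are the choices of a parent outside the block and inside it.
  block-identity : ∀ P C x y z → y * (P * (x + y) * C) + z * (P * y * C) ≡ (x + (y + z)) * P * y * C
  block-identity = solve 5 (λ P C x y z →
    y :* (P :* (x :+ y) :* C) :+ z :* (P :* y :* C) := (x :+ (y :+ z)) :* P :* y :* C) refl
    where open +-*-Solver

  Outside : ℕ → (V → V) → List V → V → Set
  Outside d o bs t = len t ∣ d × o t ∉ bs

  -- Contracting r into an orbit of the block leaves y unchanged; contracting it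
  -- outside the block adds to y the number x of targets owned by r.
  size-block : ∀ {d rest C} → (∀ o → Lower d o → HasSize (Good rest o) C) →
    ∀ {S} → HasSize (λ t → len t ∣ d) S →
    ∀ bs → All (λ r → len r ≡ d) bs → Unique bs →
    ∀ o → Lower d o → ∀ {y} → HasSize (Outside d o bs) y →
    HasSize (Good (bs ++ rest) o) (blockCount (length bs) S y * C)
  size-block {C = C} restSize sizeT [] _ _ o low _ = subst (HasSize _) (sym (+-identityʳ C)) (restSize o low)
  -- One orbit is treated apart, because the exponent `k - 2` exists only from two orbits on.
  size-block {d} {rest} {C} restSize sizeT (r ∷ []) (refl ∷ []) _ o low {y} sizeY =
    subst (HasSize _) (cong (_* C) (sym (+-identityʳ y)))
      (size-cong (λ g → mk⇔
         (λ { ((t , g) , ((div , ∉) , good) , refl) → div , (λ e → ∉ (here e)) , good })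
         (split g))
       (size-∷ sizeY (λ t _ → restSize _ (lower-merge refl low))))
    where
    split : ∀ g → Good (r ∷ rest) o g → ∃ λ (tg : V × List V) →
      (Outside d o (r ∷ []) (proj₁ tg) × Good rest (merge r (o (proj₁ tg)) o) (proj₂ tg)) × proj₁ tg ∷ proj₂ tg ≡ g
    split (t ∷ g) (div , ≢ , good) = (t , g) , ((div , λ { (here e) → ≢ e ; (there ()) }) , good) , refl
  size-block {d} {rest} {C} restSize {S} sizeT (r ∷ bs@(_ ∷ bs′)) (lr ∷ lbs) (r∉ ∷ u) o low {y} sizeY =
    subst (HasSize _) total (size-cong (λ g → mk⇔ join (split g)) (size-⊎ disjoint fromOutside fromInside))
    where
    HitsR InBlock : V → Set
    HitsR t = len t ∣ d × o t ≡ r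
    InBlock t = len t ∣ d × o t ∈ bs

    r∉bs : r ∉ bs
    r∉bs i = All.lookup r∉ i refl

    sizeX : HasSize HitsR _
    sizeX = size-filter λ t → (len t ∣? d) ×-dec (o t ≟ᶠ r)
    sizeZ : HasSize InBlock _
    sizeZ = size-filter λ t → (len t ∣? d) ×-dec (o t ∈? bs)
    x z : ℕ
    x = length (proj₁ sizeX)
    z = length (proj₁ sizeZ)

    S≡ : x + (y + z) ≡ S
    S≡ = size-unique (size-cong (λ t → mk⇔ (λ { (inj₁ (d , _)) → d ; (inj₂ (inj₁ (d , _))) → d ; (inj₂ (inj₂ (d , _))) → d })
         (classify t))
        (size-⊎ (λ { t (_ , e) (inj₁ (_ , ∉)) → ∉ (here e) ; t (_ , e) (inj₂ (_ , i)) → r∉bs (subst (_∈ bs) e i) })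
          sizeX (size-⊎ (λ { t (_ , ∉) (_ , i) → ∉ (there i) }) sizeY sizeZ))) sizeT
      where
      classify : ∀ t → len t ∣ d → HitsR t ⊎ Outside d o (r ∷ bs) t ⊎ InBlock t
      classify t div with o t ≟ᶠ r | o t ∈? bs
      ... | yes e | _ = inj₁ (div , e)
      ... | no _ | yes i = inj₂ (inj₂ (div , i))
      ... | no ≢ | no ∉ = inj₂ (inj₁ (div , λ { (here e) → ≢ e ; (there i) → ∉ i }))

    outside-grows : ∀ u → u ∉ bs → HasSize (Outside d (merge r u o) bs) (x + y)
    outside-grows u u∉ = size-cong (λ t → mk⇔ (⇒ t) (⇐ t))
      (size-⊎ (λ { t (_ , e) (_ , ∉) → ∉ (here e) }) sizeX sizeY)
      where
      ⇒ : ∀ t → HitsR t ⊎ Outside d o (r ∷ bs) t → Outside d (merge r u o) bs t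
      ⇒ t (inj₁ (div , e)) = div , λ i → u∉ (subst (_∈ bs) (merge-hit o e) i)
      ⇒ t (inj₂ (div , ∉)) = div , λ i → ∉ (there (subst (_∈ bs) (merge-miss o (λ e → ∉ (here e))) i))
      ⇐ : ∀ t → Outside d (merge r u o) bs t → HitsR t ⊎ Outside d o (r ∷ bs) t
      ⇐ t (div , ∉) with o t ≟ᶠ r
      ... | yes e = inj₁ (div , e)
      ... | no ≢ = inj₂ (div , λ { (here e) → ≢ e ; (there i) → ∉ i })

    outside-keeps : ∀ u → u ∈ bs → HasSize (Outside d (merge r u o) bs) y
    outside-keeps u u∈ = size-cong (λ t → mk⇔ (⇒ t) (⇐ t)) sizeY
      where
      ⇒ : ∀ t → Outside d o (r ∷ bs) t → Outside d (merge r u o) bs t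
      ⇒ t (div , ∉) = div , λ i → ∉ (there (subst (_∈ bs) (merge-miss o (λ e → ∉ (here e))) i))
      ⇐ : ∀ t → Outside d (merge r u o) bs t → Outside d o (r ∷ bs) t
      ⇐ t (div , ∉) with o t ≟ᶠ r
      ... | yes _ = contradiction u∈ ∉
      ... | no ≢ = div , λ { (here e) → ≢ e ; (there i) → ∉ i }

    Tail : V → List V → Set
    Tail t = Good (bs ++ rest) (merge r (o t) o)

    recurse : ∀ t {y′} → HasSize (Outside d (merge r (o t) o) bs) y′ → HasSize (Tail t) (S ^ length bs′ * y′ * C)
    recurse t = size-block restSize sizeT bs lbs u (merge r (o t) o) (lower-merge lr low)

    fromOutside = size-∷ {Q = Tail} sizeY (λ t (_ , ∉) → recurse t (outside-grows (o t) (∉ ∘ there)))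
    fromInside = size-∷ {Q = Tail} sizeZ (λ t (_ , i) → recurse t (outside-keeps (o t) i))

    Cons : (V → Set) → List V → Set
    Cons P g = ∃ λ (tg : V × List V) → (P (proj₁ tg) × Tail (proj₁ tg) (proj₂ tg)) × proj₁ tg ∷ proj₂ tg ≡ g

    disjoint : ∀ g → Cons (Outside d o (r ∷ bs)) g → ¬ Cons InBlock g
    disjoint g (_ , ((_ , ∉) , _) , refl) (_ , ((_ , i) , _) , refl) = ∉ (there i)

    join : ∀ {g} → Cons (Outside d o (r ∷ bs)) g ⊎ Cons InBlock g → Good (r ∷ bs ++ rest) o g
    join (inj₁ (_ , ((div , ∉) , good) , refl)) = subst (_ ∣_) (sym lr) div , (λ e → ∉ (here e)) , good
    join (inj₂ (_ , ((div , i) , good) , refl)) = subst (_ ∣_) (sym lr) div , (λ e → r∉bs (subst (_∈ bs) e i)) , good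

    split : ∀ g → Good (r ∷ bs ++ rest) o g → Cons (Outside d o (r ∷ bs)) g ⊎ Cons InBlock g
    split (t ∷ g) (div , ≢ , good) with o t ∈? bs
    ... | yes i = inj₂ (_ , ((subst (_ ∣_) lr div , i) , good) , refl)
    ... | no ∉ = inj₁ (_ , ((subst (_ ∣_) lr div , λ { (here e) → ≢ e ; (there i) → ∉ i }) , good) , refl)

    total : y * (S ^ length bs′ * (x + y) * C) + z * (S ^ length bs′ * y * C) ≡ S ^ suc (length bs′) * y * C
    total = trans (block-identity (S ^ length bs′) C x y z) (cong (λ S₁ → S₁ * S ^ length bs′ * y * C) S≡)


  -- Orbits and possible parents by cycle length

  Rep : ℕ → V → Set
  Rep d r = rep r ≡ r × len r ≡ d

  IsRoot : V → Set
  IsRoot = _≡ zero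

  orbits? : ∀ d r → Dec (Rep d r × ¬ IsRoot r)
  orbits? d r = ((rep r ≟ᶠ r) ×-dec (len r ≟ d)) ×-dec ¬? (r ≟ᶠ zero)

  orbits : ℕ → List V
  orbits d = filter (orbits? d) (allFin (suc m))

  -- Longest cycles come first, so that the shorter ones are uncontracted when their turn comes.
  orbitsUpTo : ℕ → List V
  orbitsUpTo zero = []
  orbitsUpTo (suc d) = orbits (suc d) ++ orbitsUpTo d

  size-orbits : ∀ d → HasSize (λ r → Rep d r × ¬ IsRoot r) (length (orbits d))
  size-orbits d = size-filter (orbits? d)

  ∈-orbits : ∀ d r → r ∈ orbits d ⇔ (Rep d r × ¬ IsRoot r)
  ∈-orbits d = proj₁ (proj₂ (proj₂ (size-orbits d)))

  size-len : ∀ d → HasSize (λ i → len i ≡ suc d) (lam σ (suc d) * suc d)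
  size-Rep : ∀ d → HasSize (Rep (suc d)) (lam σ (suc d))

  private
    Rep? : ∀ d r → Dec (Rep d r)
    Rep? d r = (rep r ≟ᶠ r) ×-dec (len r ≟ d)

    size-len-Rep : ∀ d → HasSize (λ i → len i ≡ d) (length (filter (Rep? d) (allFin (suc m))) * d)
    size-len-Rep d = size-cong
      (λ i → mk⇔ (λ { ((r , _) , ((_ , e) , refl) , refl) → trans (sym (len-rep i)) e })
                 (λ e → (rep i , i) , ((rep-idem i , trans (len-rep i) e) , refl) , refl))
      (size-image proj₂ (λ { _ _ (_ , refl) (_ , refl) refl → refl })
        (size-Σ {Q = λ r i → rep i ≡ r} (size-filter (Rep? d)) (λ { r (e , refl) → size-orbit r e })))

    -- The division in `lam` is exact, since the vertices of a given cycle length fall into orbits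
    -- of that size, one for each representative.
    lam≡ : ∀ d → lam σ (suc d) ≡ length (filter (Rep? (suc d)) (allFin (suc m)))
    lam≡ d = trans (cong (λ N → N / suc d)
      (size-unique (size-filter (λ i → len i ≟ suc d)) (size-len-Rep (suc d)))) (m*n/n≡m _ (suc d))

  size-len d = subst (λ k → HasSize (λ i → len i ≡ suc d) (k * suc d)) (sym (lam≡ d)) (size-len-Rep (suc d))
  size-Rep d = subst (HasSize _) (sym (lam≡ d)) (size-filter (Rep? (suc d)))

  -- Separating the bound `b` from `d` permits induction along `upTo`; `mu` is the case `b = d`.
  size-below : ∀ d b → HasSize (λ t → len t ∣ d × len t < b)
    (sum (map (λ e → if does (e ∣? d) then e * lam σ e else 0) (upTo b)))
  size-below d zero = size-empty λ { _ (_ , ()) }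
  size-below d (suc b) = subst (HasSize _)
    (sym (trans (cong (λ l → sum (map term l)) (sym (upTo-∷ʳ b)))
      (trans (cong sum (map-++ term (upTo b) (b ∷ [])))
        (trans (sum-++ (map term (upTo b)) _) (cong (sum (map term (upTo b)) +_) (+-identityʳ (term b)))))))
    (size-cong (λ t → mk⇔ (λ { (inj₁ (div , lt)) → div , m≤n⇒m≤1+n lt ; (inj₂ (div , refl)) → div , ≤-refl })
                          (split t))
      (size-⊎ (λ { t (_ , lt) (_ , e) → <⇒≢ lt e }) (size-below d b) (atLevel b)))
    where
    term : ℕ → ℕ
    term e = if does (e ∣? d) then e * lam σ e else 0
    split : ∀ t → len t ∣ d × len t < suc b → (len t ∣ d × len t < b) ⊎ (len t ∣ d × len t ≡ b)
    split t (div , lt) with len t ≟ b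
    ... | yes e = inj₂ (div , e)
    ... | no ≢ = inj₁ (div , ≤∧≢⇒< (s≤s⁻¹ lt) ≢)
    atLevel : ∀ e → HasSize (λ t → len t ∣ d × len t ≡ e) (term e)
    atLevel e with e ∣? d
    atLevel e | no e∤d = size-empty λ { _ (div , refl) → e∤d div }
    atLevel zero | yes _ = size-empty λ { t (_ , e) → <⇒≢ (len>0 t) (sym e) }
    atLevel (suc e) | yes e∣d = subst (HasSize _) (*-comm (lam σ (suc e)) (suc e))
      (size-cong (λ t → mk⇔ (λ { e → subst (_∣ d) (sym e) e∣d , e }) proj₂) (size-len e))

  size-mu : ∀ d → HasSize (λ t → len t ∣ d × len t < d) (mu σ d)
  size-mu d = size-below d d

  size-targets : ∀ d → HasSize (λ t → len t ∣ suc d) (lam σ (suc d) * suc d + mu σ (suc d))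
  size-targets d = size-cong
    (λ t → mk⇔ (λ { (inj₁ e) → ∣-reflexive e ; (inj₂ (div , _)) → div }) (split t))
    (size-⊎ (λ { t e (_ , lt) → <⇒≢ lt e }) (size-len d) (size-mu (suc d)))
    where
    split : ∀ t → len t ∣ suc d → len t ≡ suc d ⊎ (len t ∣ suc d × len t < suc d)
    split t div with len t ≟ suc d
    ... | yes e = inj₁ e
    ... | no ≢ = inj₂ (div , ≤∧≢⇒< (∣⇒≤ div) ≢)

  level : ℕ → ℕ
  level d = blockCount (length (orbits d)) (lam σ d * d + mu σ d) (if does (d ≟ 1) then 1 else mu σ d)

  -- Among the fixed points only the root is missing from `orbits 1`. For longer cycles every orbit
  -- of full length is in the block, which leaves the vertices on shorter cycles.
  size-outside : ∀ d → HasSize (Outside (suc d) rep (orbits (suc d))) (if does (suc d ≟ 1) then 1 else mu σ (suc d))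
  size-outside zero = size-singleton zero λ t → mk⇔
    (λ { refl → subst (_∣ 1) (sym len-zero) ∣-refl ,
                λ i → proj₂ (to (∈-orbits 1 (rep zero)) i) rep-zero })
    (λ (div , ∉) → isRoot t div ∉)
    where
    isRoot : ∀ t → len t ∣ 1 → rep t ∉ orbits 1 → t ≡ zero
    isRoot t div ∉ with rep t ≟ᶠ zero
    ... | yes e = rep≡zero t e
    ... | no ≢ = contradiction (from (∈-orbits 1 (rep t)) ((rep-idem t , trans (len-rep t) (∣1⇒≡1 div)) , ≢)) ∉
  size-outside (suc d) = size-cong
    (λ t → mk⇔ (λ (div , lt) → div , λ i →
                  <⇒≢ lt (trans (sym (len-rep t)) (proj₂ (proj₁ (to (∈-orbits (2 + d) (rep t)) i)))))
               (λ (div , ∉) → div , ≤∧≢⇒< (∣⇒≤ div) λ e → ∉ (from (∈-orbits (2 + d) (rep t))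
                  ((rep-idem t , trans (len-rep t) e) , λ z → >1 (trans (sym e) (trans (cong len (rep≡zero t z)) len-zero))))))
    (size-mu (2 + d))
    where
    >1 : 2 + d ≢ 1
    >1 ()

  levels : ℕ → ℕ
  levels zero = 1
  levels (suc d) = level (suc d) * levels d

  -- The count is the same for every owner map untouched on cycles of length at most `d`, whichever
  -- contractions produced it; `size-block` asks this of `rest`.
  size-levels : ∀ d o → Lower (suc d) o → HasSize (Good (orbitsUpTo d) o) (levels d)
  size-levels zero o _ = size-singleton [] λ where
    [] → mk⇔ (λ _ → tt) (λ _ → refl)
    (_ ∷ _) → mk⇔ (λ ()) (λ ())
  size-levels (suc d) o low = size-block (size-levels d) (size-targets d) (orbits (suc d))
    (All.tabulate λ i → proj₂ (proj₁ (to (∈-orbits (suc d) _) i)))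
    (proj₁ (proj₂ (size-orbits (suc d)))) o (λ t lt → low t (m≤n⇒m≤1+n lt))
    (size-cong (λ t → mk⇔ (λ (div , ∉) → div , ∉ ∘ subst (_∈ orbits (suc d)) (low t (s≤s (∣⇒≤ div))))
                          (λ (div , ∉) → div , ∉ ∘ subst (_∈ orbits (suc d)) (sym (low t (s≤s (∣⇒≤ div))))))
      (size-outside d))

  -- The extra one is the root, a fixed point without a parent.
  length-orbits-one : suc (length (orbits 1)) ≡ lam σ 1
  length-orbits-one = size-unique
    (size-cong (λ r → mk⇔ (λ { (inj₁ refl) → rep-zero , len-zero ; (inj₂ (p , _)) → p }) (split r))
      (size-⊎ (λ { r e (_ , ≢) → ≢ e }) (size-singleton {P = IsRoot} zero (λ _ → mk⇔ id id)) (size-orbits 1)))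
    (size-Rep 0)
    where
    split : ∀ r → Rep 1 r → IsRoot r ⊎ (Rep 1 r × ¬ IsRoot r)
    split r p with r ≟ᶠ zero
    ... | yes e = inj₁ e
    ... | no ≢ = inj₂ (p , ≢)

  length-orbits : ∀ d → length (orbits (2 + d)) ≡ lam σ (2 + d)
  length-orbits d = size-unique
    (size-cong (λ r → mk⇔ proj₁ (λ p → p , λ { refl → contradiction (trans (sym (proj₂ p)) len-zero) λ () }))
      (size-orbits (2 + d)))
    (size-Rep (suc d))

  -- Evaluation of the closed formula

  -- A named copy of the function local to `formula`.
  factor : ℕ → ℕ
  factor d = if does (d <? 2) then 1 else if does (lam σ d ≟ 0) then 1 else f (lam σ d) d (mu σ d)

  formula≡ : formula σ ≡ lam σ 1 ^ (lam σ 1 ∸ 2) * product (map factor (upTo (2 + m)))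
  formula≡ = refl

  blockCount≡ : ∀ k d y → blockCount k (k * d + y) y ≡ (if does (k ≟ 0) then 1 else f k d y)
  blockCount≡ zero d y = refl
  blockCount≡ (suc k) d y = refl

  level≡factor : ∀ d → level (2 + d) ≡ factor (2 + d)
  level≡factor d = trans
    (cong (λ k → blockCount k (lam σ (2 + d) * (2 + d) + mu σ (2 + d)) (mu σ (2 + d))) (length-orbits d))
    (blockCount≡ (lam σ (2 + d)) (2 + d) (mu σ (2 + d)))

  -- Cayley's formula for the root and `k` further fixed points; truncated subtraction gives 1 at
  -- `k = 0`.
  blockCount-one : ∀ k → blockCount k (suc k * 1 + 0) 1 ≡ suc k ^ (suc k ∸ 2)
  blockCount-one zero = refl
  blockCount-one (suc k) = trans (*-identityʳ _)
    (cong (_^ k) (trans (+-identityʳ (suc (suc k) * 1)) (*-identityʳ (suc (suc k)))))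

  level-one : level 1 ≡ lam σ 1 ^ (lam σ 1 ∸ 2)
  level-one = trans (cong (λ l → blockCount (length (orbits 1)) (l * 1 + 0) 1) (sym length-orbits-one))
    (trans (blockCount-one (length (orbits 1))) (cong (λ l → l ^ (l ∸ 2)) length-orbits-one))

  levels≡ : ∀ d → levels (suc d) ≡ level 1 * product (map factor (upTo (2 + d)))
  -- `factor 0` and `factor 1` are both 1.
  levels≡ zero = refl
  levels≡ (suc d) = trans (cong₂ _*_ (level≡factor d) (levels≡ d))
    (trans (rearrange (factor (2 + d)) (level 1) _)
      (cong (level 1 *_) (sym
        (trans (cong (λ l → product (map factor l)) (sym (upTo-∷ʳ (2 + d))))
          (trans (cong product (map-++ factor (upTo (2 + d)) (2 + d ∷ [])))
            (product-++ (map factor (upTo (2 + d))) _))))))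
    where
    rearrange : ∀ a b c → a * (b * c) ≡ b * (c * (a * 1))
    rearrange = solve 3 (λ a b c → a :* (b :* c) := b :* (c :* (a :* con 1))) refl
      where open +-*-Solver

  size-Good : HasSize (Good (orbitsUpTo (suc m)) rep) (formula σ)
  size-Good = subst (HasSize _)
    (trans (levels≡ m) (trans (cong (_* product (map factor (upTo (2 + m)))) level-one) (sym formula≡)))
    (size-levels (suc m) rep λ _ _ → refl)

  -- Good lists and rooted commuting functions

  reps : List V
  reps = orbitsUpTo (suc m)

  ∈-orbitsUpTo : ∀ d r → r ∈ orbitsUpTo d ⇔ ((rep r ≡ r × len r ≤ d) × r ≢ zero)
  ∈-orbitsUpTo zero r = mk⇔ (λ ()) (λ ((_ , len≤0) , _) → contradiction len≤0 (<⇒≱ (len>0 r)))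
  ∈-orbitsUpTo (suc d) r = mk⇔ ⇒ ⇐
    where
    ⇒ : r ∈ orbitsUpTo (suc d) → (rep r ≡ r × len r ≤ suc d) × r ≢ zero
    ⇒ i with ∈-++⁻ (orbits (suc d)) i
    ... | inj₁ j = let (e , l) , ≢0 = to (∈-orbits (suc d) r) j in (e , ≤-reflexive l) , ≢0
    ... | inj₂ j = let (e , l) , ≢0 = to (∈-orbitsUpTo d r) j in (e , m≤n⇒m≤1+n l) , ≢0
    ⇐ : (rep r ≡ r × len r ≤ suc d) × r ≢ zero → r ∈ orbitsUpTo (suc d)
    ⇐ ((e , l) , ≢0) with len r ≟ suc d
    ... | yes l≡ = ∈-++⁺ˡ (from (∈-orbits (suc d) r) ((e , l≡) , ≢0))
    ... | no l≢ = ∈-++⁺ʳ (orbits (suc d)) (from (∈-orbitsUpTo d r) ((e , s≤s⁻¹ (≤∧≢⇒< l l≢)) , ≢0))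

  orbitsUpTo-unique : ∀ d → Unique (orbitsUpTo d)
  orbitsUpTo-unique zero = []
  orbitsUpTo-unique (suc d) = UniqueP.++⁺ (proj₁ (proj₂ (size-orbits (suc d)))) (orbitsUpTo-unique d)
    λ {r} (i , j) → <⇒≱ (≤-reflexive (sym (proj₂ (proj₁ (to (∈-orbits (suc d) r) i)))))
                        (proj₂ (proj₁ (to (∈-orbitsUpTo d r) j)))

  rep-∈ : ∀ v → v ≢ zero → rep v ∈ reps
  rep-∈ v v≢0 = from (∈-orbitsUpTo (suc m) (rep v)) ((rep-idem v , len≤n (rep v)) , v≢0 ∘ rep≡zero v)

  ∈-reps⇒≢0 : ∀ {r} → r ∈ reps → r ≢ zero
  ∈-reps⇒≢0 {r} i = proj₂ (to (∈-orbitsUpTo (suc m) r) i)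

  ∈-reps⇒rep : ∀ {r} → r ∈ reps → rep r ≡ r
  ∈-reps⇒rep {r} i = proj₁ (proj₁ (to (∈-orbitsUpTo (suc m) r) i))

  Commutes : (V → V) → Set
  Commutes p = ∀ v → p (s v) ≡ s (p v)

  commutes-iter : ∀ {p} → Commutes p → ∀ k v → p (iter σ k v) ≡ iter σ k (p v)
  commutes-iter c zero v = refl
  commutes-iter c (suc k) v = trans (c (iter σ k v)) (cong s (commutes-iter c k v))

  -- Iterating `len v` times fixes `v` and commutes with `p`, so it fixes `p v`.
  commutes-len : ∀ {p} → Commutes p → ∀ v → len (p v) ∣ len v
  commutes-len {p} c v = to (returns⇔len∣ (p v) (len v))
    (trans (sym (commutes-iter c (len v) v)) (cong p (len-returns v)))

  s≢0 : ∀ {v} → v ≢ zero → s v ≢ zero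
  s≢0 v≢0 e = v≢0 (s-injective (trans e (sym σ0)))

  module _ {p : V → V} where

    rooted-s : Commutes p → ∀ {v} → Rooted p v → Rooted p (s v)
    rooted-s c root = subst (Rooted p) (sym σ0) root
    rooted-s c {v} (step v≢0 r) = step (s≢0 v≢0) (subst (Rooted p) (sym (c v)) (rooted-s c r))

    rooted-iter : Commutes p → ∀ k {v} → Rooted p v → Rooted p (iter σ k v)
    rooted-iter c zero r = r
    rooted-iter c (suc k) r = rooted-s c (rooted-iter c k r)

    rooted-step : ∀ {v} → Rooted p (p v) → Rooted p v
    rooted-step {v} r with v ≟ᶠ zero
    ... | yes refl = root
    ... | no v≢0 = step v≢0 r

    -- Invariant: a vertex is rooted once its owner is. If `r` owns `t`, the new owner gives
    -- rootedness of `p r`, hence of `r`, hence of `t`. At the end the root owns everything.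
    good⇒rooted : ∀ rs o → Good rs o (map p rs) → (∀ t → o t ∈ zero ∷ rs) →
      (∀ t → Rooted p (o t) → Rooted p t) → ∀ t → Rooted p t
    good⇒rooted [] o _ range back t with range t
    ... | here e = back t (subst (Rooted p) (sym e) root)
    good⇒rooted (r ∷ rs) o (_ , ≢r , good) range back = good⇒rooted rs (merge r (o (p r)) o) good range′ back′
      where
      without : ∀ {v} → v ≢ r → v ∈ zero ∷ r ∷ rs → v ∈ zero ∷ rs
      without _ (here e) = here e
      without v≢r (there (here e)) = contradiction e v≢r
      without _ (there (there i)) = there i
      range′ : ∀ t → merge r (o (p r)) o t ∈ zero ∷ rs
      range′ t with o t ≟ᶠ r
      ... | yes _ = without ≢r (range (p r))
      ... | no ot≢r = without ot≢r (range t)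
      back′ : ∀ t → Rooted p (merge r (o (p r)) o t) → Rooted p t
      back′ t with o t ≟ᶠ r
      ... | yes refl = back t ∘ rooted-step ∘ back (p r)
      ... | no _ = back t

    -- Invariant: owners are never deeper than what they own. The owner of `p r` is thus strictly
    -- closer to the root than `r`, and no loop arises.
    rooted⇒good : (rooted : ∀ v → Rooted p v) → (∀ v → len (p v) ∣ len v) → ∀ rs o → (∀ {r} → r ∈ rs → r ≢ zero) →
      (∀ t → height rooted (o t) ≤ height rooted t) → Good rs o (map p rs)
    rooted⇒good rooted div [] o _ _ = tt
    rooted⇒good rooted div (r ∷ rs) o ≢0 lower = div r , (λ e → <⇒≢ below (cong (height rooted) e)) ,
      rooted⇒good rooted div rs (merge r (o (p r)) o) (≢0 ∘ there) lower′
      where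
      below : height rooted (o (p r)) < height rooted r
      below = ≤-<-trans (lower (p r)) (height-< rooted (≢0 (here refl)))
      lower′ : ∀ t → height rooted (merge r (o (p r)) o t) ≤ height rooted t
      lower′ t with o t ≟ᶠ r
      ... | yes refl = ≤-trans (<⇒≤ below) (lower t)
      ... | no _ = lower t

    -- Constant height on orbits gives the initial owner map `rep` the invariant of `rooted⇒good`.
    height-iter : Commutes p → (rooted : ∀ v → Rooted p v) → ∀ k v → height rooted (iter σ k v) ≡ height rooted v
    height-iter c rooted zero v = refl
    height-iter c rooted (suc k) v = trans (height-s (iter σ k v)) (height-iter c rooted k v)
      where
      depth-subst : ∀ {v w} (e : v ≡ w) (r : Rooted p v) → depth (subst (Rooted p) e r) ≡ depth r
      depth-subst refl r = refl
      depth-s : ∀ {v} (r : Rooted p v) → depth (rooted-s c r) ≡ depth r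
      depth-s root = depth-subst (sym σ0) root
      depth-s (step v≢0 r) = cong suc (trans (depth-subst (sym (c _)) (rooted-s c r)) (depth-s r))
      height-s : ∀ v → height rooted (s v) ≡ height rooted v
      height-s v = trans (depth-unique (rooted (s v)) (rooted-s c (rooted v))) (depth-s (rooted v))

    reps-good⇒rooted : Commutes p → Good reps rep (map p reps) → ∀ v → Rooted p v
    reps-good⇒rooted c good = good⇒rooted reps rep good range
      (λ t r → subst (Rooted p) (iter-exponent t) (rooted-iter c (exponent t) r))
      where
      range : ∀ t → rep t ∈ zero ∷ reps
      range t with t ≟ᶠ zero
      ... | yes refl = here rep-zero
      ... | no t≢0 = there (rep-∈ t t≢0)

    rooted⇒reps-good : Commutes p → (∀ v → Rooted p v) → Good reps rep (map p reps)
    rooted⇒reps-good c rooted = rooted⇒good rooted (commutes-len c) reps rep ∈-reps⇒≢0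
      (λ t → ≤-reflexive (trans (sym (height-iter c rooted (exponent t) (rep t))) (cong (height rooted) (iter-exponent t))))

  -- Extension from representatives to all vertices

  find : List V → List V → V → V
  -- The default serves the root, which is not among `reps`.
  find [] _ _ = zero
  find (_ ∷ _) [] _ = zero
  find (r ∷ rs) (t ∷ g) v with v ≟ᶠ r
  ... | yes _ = t
  ... | no _ = find rs g v

  find-∉ : ∀ rs g {v} → v ∉ rs → find rs g v ≡ zero
  find-∉ [] _ _ = refl
  find-∉ (_ ∷ _) [] _ = refl
  find-∉ (r ∷ rs) (t ∷ g) {v} v∉ with v ≟ᶠ r
  ... | yes e = contradiction (here e) v∉
  ... | no _ = find-∉ rs g (v∉ ∘ there)

  find-map : ∀ p rs {v} → v ∈ rs → find rs (map p rs) v ≡ p v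
  find-map p (r ∷ rs) {v} i with v ≟ᶠ r
  ... | yes refl = refl
  find-map p (r ∷ rs) (here e) | no ≢ = contradiction e ≢
  find-map p (r ∷ rs) (there i) | no _ = find-map p rs i

  map-find : ∀ rs {o} g → Unique rs → Good rs o g → map (find rs g) rs ≡ g
  map-find [] [] _ _ = refl
  map-find (r ∷ rs) (t ∷ g) (r∉ ∷ u) (_ , _ , good) = cong₂ _∷_ hit
    (trans (map-cong-local (All.map miss r∉)) (map-find rs g u good))
    where
    hit : find (r ∷ rs) (t ∷ g) r ≡ t
    hit with r ≟ᶠ r
    ... | yes _ = refl
    ... | no ≢ = contradiction refl ≢
    miss : ∀ {v} → r ≢ v → find (r ∷ rs) (t ∷ g) v ≡ find rs g v
    miss {v} r≢v with v ≟ᶠ r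
    ... | yes refl = contradiction refl r≢v
    ... | no _ = refl

  find-len : ∀ rs {o} g → Good rs o g → ∀ v → len (find rs g v) ∣ len v
  find-len [] [] _ v = subst (_∣ len v) (sym len-zero) (1∣ len v)
  find-len (r ∷ rs) (t ∷ g) (div , _ , good) v with v ≟ᶠ r
  ... | yes refl = div
  ... | no _ = find-len rs g good v

  -- Exponents that agree on `r` differ by a multiple of `len r`, hence of `len w`. This makes
  -- `extend` independent of the exponent.
  iter-transfer : ∀ {r w} → len w ∣ len r → ∀ a b → iter σ a r ≡ iter σ b r → iter σ a w ≡ iter σ b w
  iter-transfer {r} {w} div a b e = [ (λ a≤b → go a b a≤b e) , (λ b≤a → sym (go b a b≤a (sym e))) ]′ (≤-total a b)
    where
    shift : ∀ {a b} → a ≤ b → ∀ v → iter σ b v ≡ iter σ a (iter σ (b ∸ a) v)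
    shift {a} {b} a≤b v = trans (cong (λ k → iter σ k v) (sym (m+[n∸m]≡n a≤b))) (iter-+ a (b ∸ a) v)
    go : ∀ a b → a ≤ b → iter σ a r ≡ iter σ b r → iter σ a w ≡ iter σ b w
    go a b a≤b e = sym (trans (shift a≤b w) (cong (iter σ a)
      (from (returns⇔len∣ w (b ∸ a)) (∣-trans div (to (returns⇔len∣ r (b ∸ a))
        (iter-injective a (sym (trans e (shift a≤b r)))))))))

  -- Commuting with `σ` forces this value, since `v` is the same iterate of `rep v`.
  extend : List V → V → V
  extend g v = iter σ (exponent v) (find reps g (rep v))

  extend-zero : ∀ g → extend g zero ≡ zero
  extend-zero g = trans (cong (iter σ (exponent zero))
    (find-∉ reps g (λ i → ∈-reps⇒≢0 i rep-zero))) (iter-zero (exponent zero))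

  module _ {g : List V} (good : Good reps rep g) where

    -- Both `exponent (s v)` and `suc (exponent v)` carry the representative to `s v`.
    extend-commutes : Commutes (extend g)
    extend-commutes v = trans (cong (iter σ (exponent (s v)) ∘ find reps g) (rep-iter 1 v))
      (iter-transfer (find-len reps g good (rep v)) (exponent (s v)) (suc (exponent v))
        (trans (cong (iter σ (exponent (s v))) (sym (rep-iter 1 v)))
          (trans (iter-exponent (s v)) (cong s (sym (iter-exponent v))))))

    map-extend : map (extend g) reps ≡ g
    map-extend = trans (map-cong-local (All.tabulate atRep)) (map-find reps g (orbitsUpTo-unique (suc m)) good)
      where
      atRep : ∀ {r} → r ∈ reps → extend g r ≡ find reps g r
      atRep {r} i = trans (cong (iter σ (exponent r) ∘ find reps g) (∈-reps⇒rep i))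
        (iter-transfer (find-len reps g good r) (exponent r) 0
          (trans (cong (iter σ (exponent r)) (sym (∈-reps⇒rep i))) (iter-exponent r)))

    extend-rooted : ∀ v → Rooted (extend g) v
    extend-rooted = reps-good⇒rooted extend-commutes (subst (Good reps rep) (sym map-extend) good)

  extend-map : ∀ {p} → Commutes p → p zero ≡ zero → ∀ v → extend (map p reps) v ≡ p v
  extend-map {p} c p0 v with v ≟ᶠ zero
  ... | yes refl = trans (extend-zero (map p reps)) (sym p0)
  ... | no v≢0 = trans (cong (iter σ (exponent v)) (find-map p reps (rep-∈ v v≢0)))
    (trans (sym (commutes-iter c (exponent v) (rep v))) (cong p (iter-exponent v)))

  -- Good lists correspond to invariant trees

  matrix-cong : ∀ {p q} → (∀ v → p v ≡ q v) → matrix p ≡ matrix q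
  matrix-cong {p} {q} eq = matrix-unique (matrix q) λ i j → mk⇔
    ((λ { (inj₁ (≢0 , e)) → inj₁ (≢0 , trans (eq i) e) ; (inj₂ (≢0 , e)) → inj₂ (≢0 , trans (eq j) e) }) ∘ to (matrix-edge q i j))
    (from (matrix-edge q i j) ∘ λ { (inj₁ (≢0 , e)) → inj₁ (≢0 , trans (sym (eq i)) e) ; (inj₂ (≢0 , e)) → inj₂ (≢0 , trans (sym (eq j)) e) })

  matrix-invariant : ∀ {p} → Commutes p → Invariant σ (matrix p)
  matrix-invariant {p} c i j = from (matrix-edge p (s i) (s j)) ∘ move ∘ to (matrix-edge p i j)
    where
    move : ParentEdge p i j → ParentEdge p (s i) (s j)
    move (inj₁ (≢0 , e)) = inj₁ (s≢0 ≢0 , trans (c i) (cong s e))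
    move (inj₂ (≢0 , e)) = inj₂ (s≢0 ≢0 , trans (c j) (cong s e))

  invariant-tree⇔good : ∀ A → (∃ λ g → Good reps rep g × matrix (extend g) ≡ A) ⇔ IsInvariantTree σ A
  invariant-tree⇔good A = mk⇔
    (λ { (g , good , refl) → matrix-tree (extend-rooted good) , matrix-invariant (extend-commutes good) })
    ⇐
    where
    ⇐ : IsInvariantTree σ A → ∃ λ g → Good reps rep g × matrix (extend g) ≡ A
    ⇐ (tree , inv) = map parent reps , rooted⇒reps-good commutes parent-rooted ,
      trans (matrix-cong (extend-map commutes refl)) matrix-parent
      where
      open Parent tree
      commutes : Commutes parent
      commutes = parent-commutes s s-injective σ0 inv

  number-of-invariant-trees : NumberOf (IsInvariantTree σ) (formula σ)
  number-of-invariant-trees = size-cong invariant-tree⇔good (size-image (matrix ∘ extend) injective size-Good)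
    where
    injective : ∀ g g′ → Good reps rep g → Good reps rep g′ → matrix (extend g) ≡ matrix (extend g′) → g ≡ g′
    -- The matrix determines `extend g`, whose values on `reps` are the entries of `g`.
    injective g g′ good good′ e = trans (sym (map-extend good)) (trans
      (map-cong (sym ∘ matrix-injective (extend-rooted good) (extend-zero g) (extend-zero g′) e) reps)
      (map-extend good′))

mainTheorem1 : (m : ℕ) (σ : Permutation′ (suc m)) → σ ⟨$⟩ʳ zero ≡ zero →
    NumberOf (IsInvariantTree σ) (formula σ)
mainTheorem1 = InvariantTrees.number-of-invariant-trees
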